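{- Let $H=H(n,r,q\mid\sigma)$ be a $\sigma$-hypergraph, where $\sigma$ is a partition of $r$ with $s=s(\sigma)\ge 2$ parts. If $q\ge r(r-1)$ and $n\ge s+1$, then $H$ has a sharp Hamiltonian cycle.
   Context: Let $\sigma=(a_1,\ldots,a_s)$ be a partition of the positive integer $r$ into $s=s(\sigma)$ positive parts, with largest part $\Delta$. The $\sigma$-hypergraph $H(n,r,q\mid\sigma)$ is the $r$-uniform hypergraph whose $nq$ vertices are partitioned into $n$ classes $V_1,\ldots,V_n$ of $q$ vertices each, and in which an $r$-subset $K$ of the vertices is an edge if and only if the multiset of non-zero cardinalities $|K\cap V_i|$, $1\le i\le n$, is the partition $\sigma$ of $r$. It is always assumed that $q\ge\Delta$ and $n\ge s$. A sequence $C=(e_1,\ldots,e_p)$ of edges of an $r$-uniform hypergraph $H$ is a sharp cycle if $|e_i\cap e_{i+1}|>0$ for $1\le i\le p$, with indices modulo $p$, and $|e_i\cap e_j|=0$ for all other pairs of distinct indices $i,j$. Write $V(C)=e_1\cup\cdots\cup e_p$. A sharp cycle $C$ is a sharp Hamiltonian cycle if $V(C)=V(H)$. -}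

module Defs where

open import Data.Fin.Base using (Fin; toℕ; quotient)
open import Data.Fin.Properties using (_≟_)
open import Data.Fin.Subset using (Subset; _∩_; ∣_∣; ⋃; ⊤)
open import Data.List.Base using (List; allFin; filter; map; sum; tabulate)
open import Data.List.Extrema.Nat using (max)
open import Data.List.Relation.Binary.Permutation.Propositional using (_↭_)
open import Data.List.Relation.Unary.All using (All)
open import Data.Nat.Base using (ℕ; suc; _*_; _>_; NonZero)
open import Data.Nat.DivMod using (_mod_)
open import Data.Nat.Properties using (_<?_)
open import Data.Product.Base using (Σ; _×_; proj₁)
import Data.Vec.Base as Vec
open import Relation.Binary.PropositionalEquality.Core using (_≡_; _≢_)
open import Relation.Nullary.Decidable.Core using (does)

-- The order in which the parts are listed is immaterial: partitions are
-- only ever compared up to permutation.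
record IsPartition (r : ℕ) (σ : List ℕ) : Set where
  field
    r-positive     : r > 0
    parts-positive : All (_> 0) σ
    parts-sum      : sum σ ≡ r

largestPart : List ℕ → ℕ
largestPart = max 0

record UniformHypergraph (r : ℕ) : Set₁ where
  field
    order   : ℕ
    Edge    : Subset order → Set
    uniform : ∀ {K} → Edge K → ∣ K ∣ ≡ r

-- The nq vertices are Fin (n * q), cut into n consecutive blocks of length q.
vertexClass : (n q : ℕ) → Fin n → Subset (n * q)
vertexClass n q i = Vec.tabulate (λ v → does (quotient {n} q v ≟ i))

intersectionSizes : (n q : ℕ) → Subset (n * q) → List ℕ
intersectionSizes n q K =
  filter (0 <?_) (map (λ i → ∣ K ∩ vertexClass n q i ∣) (allFin n))

σ-hypergraph : (n r q : ℕ) → List ℕ → UniformHypergraph r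
σ-hypergraph n r q σ = record
  { order   = n * q
  ; Edge    = λ K → ∣ K ∣ ≡ r × intersectionSizes n q K ↭ σ
  ; uniform = proj₁
  }

next : ∀ {p} .{{_ : NonZero p}} → Fin p → Fin p
next {p} i = suc (toℕ i) mod p

-- No lower bound on p beyond p ≥ 1 and no distinctness of edges is imposed;
-- p ≥ 1 only makes arithmetic of indices modulo p meaningful.
record SharpCycle {r : ℕ} (H : UniformHypergraph r) : Set where
  open UniformHypergraph H
  field
    p             : ℕ
    {{p≢0}}       : NonZero p
    edge          : Fin p → Subset order
    isEdge        : ∀ i → Edge (edge i)
    consecutive   : ∀ i → ∣ edge i ∩ edge (next i) ∣ > 0
    otherwise     : ∀ i j → i ≢ j → j ≢ next i → i ≢ next j →
                    ∣ edge i ∩ edge j ∣ ≡ 0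

  vertices : Subset order
  vertices = ⋃ (tabulate edge)

IsHamiltonian : ∀ {r} {H : UniformHypergraph r} → SharpCycle H → Set
IsHamiltonian C = SharpCycle.vertices C ≡ ⊤

HasSharpHamiltonianCycle : ∀ {r} → UniformHypergraph r → Set
HasSharpHamiltonianCycle H = Σ (SharpCycle H) IsHamiltonian

{-# OPTIONS --safe #-}

-- Cut a cyclic arrangement of all vertices into segments and let each edge be a
-- segment together with an initial piece of the next one: non-consecutive edges
-- are then automatically disjoint. Only the classes of the vertices matter, so
-- it suffices to find a cyclic word over the n classes in which every class
-- occurs q times and every edge has pattern σ. Such a word is built from pairs
-- of edges whose classes are translated by 1 modulo n from pair to pair; n
-- translates of one pair meet every class equally often. Choosing the overlaps,
-- this number can be anything from r to 2r ∸ 2, and for r ≥ 3 every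
-- q ≥ r (r ∸ 1) is a sum of such numbers. A graph (r = 2) needs a separate word.
module Submission where

open import Data.Bool.Base using (true; false)
open import Data.Empty using (⊥; ⊥-elim)
open import Data.Fin.Base using (Fin; zero; suc; toℕ; quotient; combine)
open import Data.Fin.Properties as Fin
  using (_≟_; toℕ<n; toℕ-fromℕ<; toℕ-injective; remQuot-combine; combine-injective; combine-surjective)
open import Data.Fin.Subset using (Subset; _∩_; ∣_∣; ⋃; ⊤; inside; outside)
  renaming (_∈_ to _∈ₛ_)
open import Data.Fin.Subset.Properties
  using (x∈p∩q⁺; x∈p∩q⁻; x∈p∪q⁺; ⊆-antisym; ∈⊤; _∈?_)
open import Data.List.Base hiding (sum)
open import Data.List.Properties
open import Data.List.Membership.Propositional using (_∈_; _∉_)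
open import Data.List.Membership.Propositional.Properties
open import Data.List.Membership.Propositional.Properties.WithK using (unique∧set⇒bag)
import Data.List.Membership.DecPropositional as DecMembership
open import Data.List.Relation.Binary.BagAndSetEquality using (∼bag⇒↭)
open import Data.List.Relation.Binary.Disjoint.Propositional using (Disjoint)
open import Data.List.Relation.Binary.Permutation.Propositional
  using (_↭_; ↭-refl; ↭-reflexive; ↭-sym; ↭-trans; ↭⇒↭ₛ; prep; module PermutationReasoning)
open import Data.List.Relation.Binary.Permutation.Propositional.Properties as ↭
  using (↭-map-inv; ↭-length; filter-↭; ∈-resp-↭)
import Data.List.Relation.Binary.Permutation.Setoid.Properties as ↭ₛ
open import Data.List.Relation.Unary.All as All using (All; []; _∷_)
import Data.List.Relation.Unary.All.Properties as All
open import Data.List.Relation.Unary.AllPairs using ([]; _∷_)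
open import Data.List.Relation.Unary.Any as Any using (here; there)
open import Data.List.Relation.Unary.Any.Properties using (lookup-index)
open import Data.List.Relation.Unary.Linked using (Linked; []; [-]; _∷_)
import Data.List.Relation.Unary.Linked.Properties as Linked
open import Data.List.Relation.Unary.Unique.Propositional using (Unique)
import Data.List.Relation.Unary.Unique.Propositional.Properties as Unique
open import Data.Nat.Base
open import Data.Nat.DivMod
open import Data.Nat.ListAction using (sum)
open import Data.Nat.Properties hiding (_≟_)
open import Data.Nat.Solver using (module +-*-Solver)
open import Algebra.Properties.CommutativeSemigroup +-commutativeSemigroup using (interchange)
open import Data.Product.Base using (∃; ∃₂; _×_; _,_; proj₁; proj₂)
open import Data.Sum.Base as Sum using (_⊎_; inj₁; inj₂)
import Data.Vec.Base as Vec
import Data.Vec.Properties as Vec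
open import Function.Base using (_∘_; _on_; id; flip)
open import Function.Bundles using (mk⇔; Equivalence; _⇔_)
open import Level using (0ℓ)
open import Relation.Binary.PropositionalEquality
open import Relation.Nullary using (does; yes; contradiction)
open import Relation.Nullary.Decidable using (dec-true)
open import Relation.Unary using (Decidable; Pred)
open import Defs

private
  variable
    A B : Set

-- Duplicate-free lists cut into segments

Unique-resp-↭ : {xs ys : List A} → xs ↭ ys → Unique xs → Unique ys
Unique-resp-↭ {A} p = ↭ₛ.Unique-resp-↭ (setoid A) (↭⇒↭ₛ p)

Unique-++⁻ : (xs {ys} : List A) → Unique (xs ++ ys) →
             Unique xs × Unique ys × Disjoint xs ys
Unique-++⁻ []       u        = [] , u , λ ()
Unique-++⁻ (x ∷ xs) (x≢ ∷ u) with Unique-++⁻ xs u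
... | uxs , uys , dis = All.++⁻ˡ xs x≢ ∷ uxs , uys , λ
  { (here refl , v∈ys) → All.lookup (All.++⁻ʳ xs x≢) v∈ys refl
  ; (there v∈xs , v∈ys) → dis (v∈xs , v∈ys) }

∈-segment : (xss : List (List A)) (i : Fin (length xss)) {v : A} →
            v ∈ lookup xss i → v ∈ concat xss
∈-segment xss i v∈ = ∈-concat⁺′ v∈ (∈-lookup {xs = xss} i)

segment-unique : (xss : List (List A)) → Unique (concat xss) →
                 ∀ i → Unique (lookup xss i)
segment-unique (xs ∷ xss) u zero    = proj₁ (Unique-++⁻ xs u)
segment-unique (xs ∷ xss) u (suc i) =
  segment-unique xss (proj₁ (proj₂ (Unique-++⁻ xs u))) i

-- Segments of a duplicate-free concatenation are disjoint, so a common vertex identifies the index.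
-- Disjointness of edges is reduced to this.
segment-index : (xss : List (List A)) → Unique (concat xss) →
                ∀ i j {v} → v ∈ lookup xss i → v ∈ lookup xss j → i ≡ j
segment-index (xs ∷ xss) u zero    zero    p q = refl
segment-index (xs ∷ xss) u zero    (suc j) p q =
  ⊥-elim (proj₂ (proj₂ (Unique-++⁻ xs u)) (p , ∈-segment xss j q))
segment-index (xs ∷ xss) u (suc i) zero    p q =
  ⊥-elim (proj₂ (proj₂ (Unique-++⁻ xs u)) (q , ∈-segment xss i p))
segment-index (xs ∷ xss) u (suc i) (suc j) p q =
  cong suc (segment-index xss (proj₁ (proj₂ (Unique-++⁻ xs u))) i j p q)

∈-take : ∀ k (xs : List A) {v} → v ∈ take k xs → v ∈ xs
∈-take (suc k) (x ∷ xs) (here p)  = here p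
∈-take (suc k) (x ∷ xs) (there p) = there (∈-take k xs p)

-- Cyclic succession

Linked-lookup : {R : A → A → Set} (xs : List A) {y : A} →
                Linked R (xs ++ y ∷ []) → ∀ i j → toℕ j ≡ suc (toℕ i) →
                R (lookup xs i) (lookup xs j)
Linked-lookup (x ∷ x′ ∷ xs) (r ∷ l) zero (suc zero) eq = r
Linked-lookup (x ∷ x′ ∷ xs) (r ∷ l) (suc i) (suc j) eq =
  Linked-lookup (x′ ∷ xs) l i j (suc-injective eq)

Linked-last : {R : A → A → Set} (xs : List A) {y : A} →
              Linked R (xs ++ y ∷ []) → ∀ i → suc (toℕ i) ≡ length xs →
              R (lookup xs i) y
Linked-last (x ∷ [])      (r ∷ l) zero    eq = r
Linked-last (x ∷ x′ ∷ xs) (r ∷ l) (suc i) eq =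
  Linked-last (x′ ∷ xs) l i (suc-injective eq)

module _ {p : ℕ} .{{_ : NonZero p}} where

  toℕ-next : (i : Fin p) →
             (suc (toℕ i) < p × toℕ (next i) ≡ suc (toℕ i)) ⊎
             (suc (toℕ i) ≡ p × toℕ (next i) ≡ 0)
  toℕ-next i with m≤n⇒m<n∨m≡n (toℕ<n i)
  ... | inj₁ lt = inj₁ (lt , trans (toℕ-fromℕ< _) (m<n⇒m%n≡m lt))
  ... | inj₂ eq = inj₂ (eq , trans (toℕ-fromℕ< _)
                              (trans (cong (_% p) eq) (n%n≡0 p)))

  next-injective : {i j : Fin p} → next i ≡ next j → i ≡ j
  next-injective {i} {j} eq with toℕ-next i | toℕ-next j
  ... | inj₁ (_ , a) | inj₁ (_ , b) =
    toℕ-injective (suc-injective (trans (sym a) (trans (cong toℕ eq) b)))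
  ... | inj₂ (a , _) | inj₂ (b , _) = toℕ-injective (suc-injective (trans a (sym b)))
  ... | inj₁ (_ , a) | inj₂ (_ , b) with () ← trans (sym a) (trans (cong toℕ eq) b)
  ... | inj₂ (_ , a) | inj₁ (_ , b) with () ← trans (sym b) (trans (cong toℕ (sym eq)) a)

  -- At the wrap-around `next i` is 0 while `i` is `p ∸ 1`, and these differ once `p` is at least 2.
  next≢ : 2 ≤ p → (i : Fin p) → next i ≢ i
  next≢ 2≤p i eq with toℕ-next i
  ... | inj₁ (_ , a) = 1+n≢n (trans (sym a) (cong toℕ eq))
  ... | inj₂ (a , b) = <⇒≢ 2≤p (trans (cong suc (sym (trans (cong toℕ (sym eq)) b))) a)

-- Repeating the first entry at the end makes the cyclic condition a linear one: the wrap-around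
-- step is the last link.
Linked-next : {R : A → A → Set} (x : A) (xs : List A) →
              Linked R (x ∷ xs ++ x ∷ []) → (i : Fin (suc (length xs))) →
              R (lookup (x ∷ xs) i) (lookup (x ∷ xs) (next i))
Linked-next {R = R} x xs l i with toℕ-next i
... | inj₁ (_ , eq) = Linked-lookup (x ∷ xs) l i (next i) eq
... | inj₂ (eq , z) = subst (λ k → R (lookup (x ∷ xs) i) (lookup (x ∷ xs) k))
                            (sym (toℕ-injective z)) (Linked-last (x ∷ xs) l i eq)

-- Subsets and duplicate-free lists

-- Without repetitions every multiplicity is 0 or 1, so equal membership already gives equal
-- multisets.
same-members⇒↭ : {xs ys : List A} → Unique xs → Unique ys →
                 (∀ v → v ∈ xs ⇔ v ∈ ys) → xs ↭ ys
same-members⇒↭ ux uy s = ∼bag⇒↭ (unique∧set⇒bag ux uy (s _))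

module _ {N : ℕ} where

  open DecMembership (_≟_ {N}) using () renaming (_∈?_ to _∈ₗ?_)

  tabulate-does⁺ : {P : Pred (Fin N) 0ℓ} (P? : Decidable P) {v : Fin N} →
                   P v → v ∈ₛ Vec.tabulate (does ∘ P?)
  tabulate-does⁺ P? {v} pv = Vec.lookup⇒[]= v _
    (trans (Vec.lookup∘tabulate (does ∘ P?) v) (dec-true (P? v) pv))

  tabulate-does⁻ : {P : Pred (Fin N) 0ℓ} (P? : Decidable P) {v : Fin N} →
                   v ∈ₛ Vec.tabulate (does ∘ P?) → P v
  tabulate-does⁻ P? {v} v∈
    with P? v | trans (sym (Vec.lookup∘tabulate (does ∘ P?) v)) (Vec.[]=⇒lookup v∈)
  ... | yes pv | _ = pv

  fromList : List (Fin N) → Subset N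
  fromList xs = Vec.tabulate (does ∘ (_∈ₗ? xs))

  ∈-fromList⁺ : ∀ {xs v} → v ∈ xs → v ∈ₛ fromList xs
  ∈-fromList⁺ = tabulate-does⁺ (_∈ₗ? _)

  ∈-fromList⁻ : ∀ {xs v} → v ∈ₛ fromList xs → v ∈ xs
  ∈-fromList⁻ = tabulate-does⁻ (_∈ₗ? _)

elements : ∀ {N} → Subset N → List (Fin N)
elements Vec.[]              = []
elements (inside  Vec.∷ K) = zero ∷ map suc (elements K)
elements (outside Vec.∷ K) = map suc (elements K)

∈-elements⁺ : ∀ {N} {K : Subset N} {v} → v ∈ₛ K → v ∈ elements K
∈-elements⁺ {K = inside  Vec.∷ K} Vec.here       = here refl
∈-elements⁺ {K = inside  Vec.∷ K} (Vec.there v∈) = there (∈-map⁺ suc (∈-elements⁺ v∈))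
∈-elements⁺ {K = outside Vec.∷ K} (Vec.there v∈) = ∈-map⁺ suc (∈-elements⁺ v∈)

∈-elements⁻ : ∀ {N} (K : Subset N) {v} → v ∈ elements K → v ∈ₛ K
∈-elements⁻ (inside  Vec.∷ K) (here refl) = Vec.here
∈-elements⁻ (inside  Vec.∷ K) (there v∈) with ∈-map⁻ suc v∈
... | _ , w∈ , refl = Vec.there (∈-elements⁻ K w∈)
∈-elements⁻ (outside Vec.∷ K) v∈ with ∈-map⁻ suc v∈
... | _ , w∈ , refl = Vec.there (∈-elements⁻ K w∈)

elements-unique : ∀ {N} (K : Subset N) → Unique (elements K)
elements-unique Vec.[] = []
elements-unique (inside  Vec.∷ K) =
  All.map⁺ (All.tabulate (λ _ ())) ∷ Unique.map⁺ Fin.suc-injective (elements-unique K)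
elements-unique (outside Vec.∷ K) = Unique.map⁺ Fin.suc-injective (elements-unique K)

∣∣≡length-elements : ∀ {N} (K : Subset N) → ∣ K ∣ ≡ length (elements K)
∣∣≡length-elements Vec.[] = refl
∣∣≡length-elements (inside  Vec.∷ K) =
  cong suc (trans (∣∣≡length-elements K) (sym (length-map suc (elements K))))
∣∣≡length-elements (outside Vec.∷ K) =
  trans (∣∣≡length-elements K) (sym (length-map suc (elements K)))

-- Two duplicate-free enumerations of one set are permutations of each other, so any of them
-- measures the set; intersections can then be counted on lists.
∣∣≡length : ∀ {N} (K : Subset N) (xs : List (Fin N)) → Unique xs →
            (∀ v → v ∈ₛ K ⇔ v ∈ xs) → ∣ K ∣ ≡ length xs
∣∣≡length K xs u s = trans (∣∣≡length-elements K) (↭-length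
  (same-members⇒↭ (elements-unique K) u λ v → mk⇔
    (Equivalence.to (s v) ∘ ∈-elements⁻ K)
    (∈-elements⁺ ∘ Equivalence.from (s v))))

nonempty⇒∣∣>0 : ∀ {N} {K : Subset N} {v} → v ∈ₛ K → ∣ K ∣ > 0
nonempty⇒∣∣>0 {K = K} v∈ rewrite ∣∣≡length-elements K with elements K | ∈-elements⁺ v∈
... | _ ∷ _ | _ = z<s

∈-⋃⁺ : ∀ {N p} (f : Fin p → Subset N) {v} i → v ∈ₛ f i → v ∈ₛ ⋃ (tabulate f)
∈-⋃⁺ f zero    v∈ = x∈p∪q⁺ (inj₁ v∈)
∈-⋃⁺ f (suc i) v∈ = x∈p∪q⁺ (inj₂ (∈-⋃⁺ (f ∘ suc) i v∈))

-- Edges as windows, and cycles from segments of vertices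

count : ∀ {n} → Fin n → List (Fin n) → ℕ
count j W = length (filter (_≟ j) W)

-- The edge that starts with the segment xs when the next segment is ys.
window : ℕ → List A → List A → List A
window r xs ys = xs ++ take (r ∸ length xs) ys

map-window : (f : A → B) (r : ℕ) (xs ys : List A) →
             map f (window r xs ys) ≡ window r (map f xs) (map f ys)
map-window f r xs ys = trans (map-++ f xs _) (cong (map f xs ++_)
  (trans (sym (take-map _ ys))
         (cong (λ k → take (r ∸ k) (map f ys)) (sym (length-map f xs)))))

-- The condition on intersection sizes, expressed through the classes of the vertices alone.
HasPattern : ∀ {n} → List ℕ → List (Fin n) → Set
HasPattern {n} σ W = filter (0 <?_) (map (λ j → count j W) (allFin n)) ↭ σ

-- `short` makes the edge that starts with `xs` reach into `ys`, so consecutive edges meet; `long`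
-- lets `ys` alone complete it to `r` vertices.
record Compatible {n} (r : ℕ) (σ : List ℕ) (xs ys : List (Fin n)) : Set where
  constructor compatible
  field
    short     : length xs < r
    long      : r ∸ length xs ≤ length ys
    patterned : HasPattern σ (window r xs ys)
open Compatible

module _ (n r q : ℕ) (σ : List ℕ) where

  private
    class : Fin (n * q) → Fin n
    class = quotient {n} q

  length-filter-class : ∀ j L → length (filter (λ v → class v ≟ j) L) ≡ count j (map class L)
  length-filter-class j [] = refl
  length-filter-class j (v ∷ L) with does (class v ≟ j)
  ... | true  = cong suc (length-filter-class j L)
  ... | false = length-filter-class j L

  intersectionSizes-fromList : ∀ {L} → Unique L → HasPattern σ (map class L) →
                               intersectionSizes n q (fromList L) ↭ σ
  intersectionSizes-fromList {L} u pat = ↭-trans (↭-reflexive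
      (cong (filter (0 <?_)) (map-cong size (allFin n)))) pat
    where
    size : ∀ j → ∣ fromList L ∩ vertexClass n q j ∣ ≡ count j (map class L)
    size j = trans (∣∣≡length _ (filter (λ v → class v ≟ j) L)
      (Unique.filter⁺ (λ v → class v ≟ j) u)
      (λ v → mk⇔
        (λ v∈ → let v∈L , v∈V = x∈p∩q⁻ (fromList L) (vertexClass n q j) v∈ in
          ∈-filter⁺ (λ v → class v ≟ j) (∈-fromList⁻ {xs = L} v∈L)
                    (tabulate-does⁻ (λ v → class v ≟ j) v∈V))
        (λ v∈ → let v∈L , eq = ∈-filter⁻ (λ v → class v ≟ j) {xs = L} v∈ in
          x∈p∩q⁺ (∈-fromList⁺ v∈L , tabulate-does⁺ (λ v → class v ≟ j) eq))))
      (length-filter-class j L)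

  module _ (x : List (Fin (n * q))) (xss : List (List (Fin (n * q))))
           (spanning : concat (x ∷ xss) ↭ allFin (n * q))
           (p≥2 : 1 ≤ length xss)
           (linked : Linked (Compatible r σ on map class) (x ∷ xss ++ x ∷ []))
           where

    private
      p : ℕ
      p = suc (length xss)

      segment : Fin p → List (Fin (n * q))
      segment = lookup (x ∷ xss)

      edgeList : Fin p → List (Fin (n * q))
      edgeList i = window r (segment i) (segment (next i))

      step : ∀ i → Compatible r σ (map class (segment i)) (map class (segment (next i)))
      step = Linked-next x xss linked

      unique : Unique (concat (x ∷ xss))
      unique = Unique-resp-↭ (↭-sym spanning) (Unique.allFin⁺ (n * q))

      length-class : ∀ L → length (map class L) ≡ length L
      length-class = length-map class

      edgeList-unique : ∀ i → Unique (edgeList i)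
      edgeList-unique i = Unique.++⁺ (segment-unique (x ∷ xss) unique i)
        (Unique.take⁺ _ (segment-unique (x ∷ xss) unique (next i)))
        -- The two pieces of an edge come from different segments because there are at least two
        -- segments.
        λ (p₁ , p₂) → next≢ (s≤s p≥2) i
          (sym (segment-index (x ∷ xss) unique i (next i) p₁ (∈-take _ _ p₂)))

      gap : ∀ i → r ∸ length (segment i) ≤ length (segment (next i))
      gap i = subst₂ (λ a b → r ∸ a ≤ b) (length-class (segment i)) (length-class (segment (next i))) (long (step i))

      shorter : ∀ i → length (segment i) < r
      shorter i = subst (_< r) (length-class (segment i)) (short (step i))

      edgeList-length : ∀ i → length (edgeList i) ≡ r
      edgeList-length i = begin
        length (edgeList i)
          ≡⟨ length-++ (segment i) ⟩
        length (segment i) + length (take (r ∸ length (segment i)) (segment (next i)))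
          ≡⟨ cong (length (segment i) +_)
               (trans (length-take _ (segment (next i))) (m≤n⇒m⊓n≡m (gap i))) ⟩
        length (segment i) + (r ∸ length (segment i))
          ≡⟨ m+[n∸m]≡n (<⇒≤ (shorter i)) ⟩
        r ∎
        where open ≡-Reasoning

      edgeList-pattern : ∀ i → HasPattern σ (map class (edgeList i))
      edgeList-pattern i = subst (HasPattern σ) (sym (map-window class r (segment i) _)) (patterned (step i))

      ∈-edgeList⁻ : ∀ i {v} → v ∈ edgeList i → v ∈ segment i ⊎ v ∈ segment (next i)
      ∈-edgeList⁻ i v∈ = Sum.map₂ (∈-take _ _) (∈-++⁻ (segment i) v∈)

      -- By `short` the edge lacks at least one vertex after its own segment, so it contains the
      -- first vertex of the next segment, where the next edge begins.
      meets : ∀ i → ∃ λ v → v ∈ edgeList i × v ∈ edgeList (next i)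
      meets i with r ∸ length (segment i) in eq | segment (next i) | gap i
      ... | zero  | _     | _ = ⊥-elim (m>n⇒m∸n≢0 (shorter i) eq)
      ... | suc k | v ∷ L | _ = v , ∈-++⁺ʳ (segment i) (here refl) , here refl

    -- Every segment lies in the edge that starts with it, and the segments exhaust the vertices, so
    -- the edges cover everything.
    segments⇒hamiltonian : HasSharpHamiltonianCycle (σ-hypergraph n r q σ)
    segments⇒hamiltonian = cycle , ⊆-antisym (λ _ → ∈⊤) (λ {v} _ → covered v)
      where
      cycle : SharpCycle (σ-hypergraph n r q σ)
      cycle = record
        { p = p
        ; p≢0 = _
        ; edge = fromList ∘ edgeList
        ; isEdge = λ i →
            trans (∣∣≡length _ (edgeList i) (edgeList-unique i) (λ v → mk⇔ ∈-fromList⁻ ∈-fromList⁺))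
                  (edgeList-length i) ,
            intersectionSizes-fromList (edgeList-unique i) (edgeList-pattern i)
        ; consecutive = λ i → let v , v∈ , v∈′ = meets i in
            nonempty⇒∣∣>0 (x∈p∩q⁺ (∈-fromList⁺ v∈ , ∈-fromList⁺ v∈′))
        ; otherwise = λ i j i≢j j≢i⁺ i≢j⁺ → ∣∣≡length _ [] [] λ v → mk⇔
            (λ v∈ → let v∈i , v∈j = x∈p∩q⁻ _ _ v∈ in
              ⊥-elim (apart i j i≢j j≢i⁺ i≢j⁺
                (∈-edgeList⁻ i (∈-fromList⁻ v∈i)) (∈-edgeList⁻ j (∈-fromList⁻ v∈j))))
            (λ ())
        }
        where
        -- Each edge lies in two cyclically consecutive segments. A common vertex forces one of four
        -- coincidences of indices, each excluded by a hypothesis or by injectivity of `next`.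
        apart : ∀ i j → i ≢ j → j ≢ next i → i ≢ next j → ∀ {v} →
                v ∈ segment i ⊎ v ∈ segment (next i) →
                v ∈ segment j ⊎ v ∈ segment (next j) → ⊥
        apart i j i≢j j≢i⁺ i≢j⁺ (inj₁ a) (inj₁ b) = i≢j (segment-index (x ∷ xss) unique i j a b)
        apart i j i≢j j≢i⁺ i≢j⁺ (inj₁ a) (inj₂ b) =
          i≢j⁺ (segment-index (x ∷ xss) unique i (next j) a b)
        apart i j i≢j j≢i⁺ i≢j⁺ (inj₂ a) (inj₁ b) =
          j≢i⁺ (sym (segment-index (x ∷ xss) unique (next i) j a b))
        apart i j i≢j j≢i⁺ i≢j⁺ (inj₂ a) (inj₂ b) =
          i≢j (next-injective (segment-index (x ∷ xss) unique (next i) (next j) a b))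

      covered : ∀ v → v ∈ₛ SharpCycle.vertices cycle
      covered v with ∈-concat⁻′ (x ∷ xss) (∈-resp-↭ (↭-sym spanning) (∈-allFin v))
      ... | L , v∈L , L∈ = ∈-⋃⁺ (SharpCycle.edge cycle) (Any.index L∈)
        (∈-fromList⁺ (∈-++⁺ˡ (subst (v ∈_) (lookup-index L∈) v∈L)))

-- Lifting a word of classes to an arrangement of the vertices

map-++⁻ : (f : A → B) (vs : List A) (xs : List B) {ys : List B} → map f vs ≡ xs ++ ys →
          ∃₂ λ us ws → vs ≡ us ++ ws × map f us ≡ xs × map f ws ≡ ys
map-++⁻ f vs       []       eq = [] , vs , refl , refl , eq
map-++⁻ f (v ∷ vs) (x ∷ xs) eq with map-++⁻ f vs xs (∷-injectiveʳ eq)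
... | us , ws , refl , equ , eqw = v ∷ us , ws , refl , cong₂ _∷_ (∷-injectiveˡ eq) equ , eqw

map-concat⁻ : (f : A → B) (vs : List A) (xss : List (List B)) → map f vs ≡ concat xss →
              ∃ λ vss → vs ≡ concat vss × map (map f) vss ≡ xss
map-concat⁻ f []  []         eq = [] , refl , refl
map-concat⁻ f vs  (xs ∷ xss) eq with map-++⁻ f vs xs eq
... | us , ws , refl , refl , eqw with map-concat⁻ f ws xss eqw
... | vss , refl , refl = us ∷ vss , refl , refl

module _ (n q : ℕ) where

  private
    -- Vertices are listed by their position inside the class, so that each position contributes one
    -- full copy of `allFin n`.
    vertexGrid : List (Fin q) → List (Fin (n * q))
    vertexGrid js = cartesianProductWith (flip combine) js (allFin n)

    map-quotient-vertexGrid : ∀ js → map (quotient {n} q) (vertexGrid js) ≡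
                              concat (replicate (length js) (allFin n))
    map-quotient-vertexGrid []       = refl
    map-quotient-vertexGrid (j ∷ js) =
      trans (map-++ (quotient q) (map (λ i → combine i j) (allFin n)) _)
      (cong₂ _++_ (trans (sym (map-∘ (allFin n)))
                    (trans (map-cong (λ i → cong proj₁ (remQuot-combine i j)) (allFin n)) (map-id (allFin n))))
                  (map-quotient-vertexGrid js))

  map-quotient-allFin : map (quotient {n} q) (allFin (n * q)) ↭ concat (replicate q (allFin n))
  map-quotient-allFin = ↭-trans (↭.map⁺ (quotient q) grid↭)
    (↭-reflexive (trans (map-quotient-vertexGrid (allFin q))
      (cong (λ k → concat (replicate k (allFin n))) (length-tabulate {n = q} id))))
    where
    grid↭ : allFin (n * q) ↭ vertexGrid (allFin q)
    grid↭ = same-members⇒↭ (Unique.allFin⁺ (n * q))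
      (Unique.cartesianProductWith⁺ (flip combine)
        (λ {w} {x} {y} {z} eq → let a , b = combine-injective y w z x eq in b , a)
        (Unique.allFin⁺ q) (Unique.allFin⁺ n))
      λ v → mk⇔ (λ _ → member v) (λ _ → ∈-allFin v)
      where
      member : ∀ v → v ∈ vertexGrid (allFin q)
      member v with combine-surjective {n} {q} v
      ... | i , j , refl = ∈-cartesianProductWith⁺ (flip combine) (∈-allFin j) (∈-allFin i)

-- The classes of all vertices form `q` copies of `allFin n`. A permutation of an image lifts to a
-- permutation of the source, so a balanced word is the class word of some arrangement of the
-- vertices, and its cuts are pulled back.
colours⇒hamiltonian : (n r q : ℕ) (σ : List ℕ) (D : List (Fin n)) (Ds : List (List (Fin n))) →
  concat (D ∷ Ds) ↭ concat (replicate q (allFin n)) → 1 ≤ length Ds →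
  Linked (Compatible r σ) (D ∷ Ds ++ D ∷ []) →
  HasSharpHamiltonianCycle (σ-hypergraph n r q σ)
colours⇒hamiltonian n r q σ D Ds balanced len linked
  with ↭-map-inv (quotient {n} q) (↭-trans (map-quotient-allFin n q) (↭-sym balanced))
... | vs , eq , vs↭ with map-concat⁻ (quotient {n} q) vs (D ∷ Ds) (sym eq)
... | v ∷ vss , refl , refl = segments⇒hamiltonian n r q σ v vss (↭-sym vs↭)
  (subst (1 ≤_) (length-map _ vss) len)
  (Linked.map⁻ (subst (Linked (Compatible r σ)) (sym (map-++ (map (quotient q)) (v ∷ vss) (v ∷ []))) linked))

-- Rearranging concatenations

-- A table has the same entries read by rows or by columns. This turns translates of a word into,
-- for each offset, a run of consecutive translates.
transpose-↭ : {C : Set} (f : A → B → C) (ys : List A) (ds : List B) →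
  concatMap (λ y → map (f y) ds) ys ↭ concatMap (λ d → map (λ y → f y d) ys) ds
transpose-↭ f ys [] = ↭-reflexive (empty ys)
  where
  empty : ∀ ys → concatMap (λ y → map (f y) []) ys ≡ []
  empty []       = refl
  empty (y ∷ ys) = empty ys
transpose-↭ f ys (d ∷ ds) = ↭-trans (firsts ys) (↭.++⁺ˡ (map (λ y → f y d) ys) (transpose-↭ f ys ds))
  where
  firsts : ∀ ys → concatMap (λ y → map (f y) (d ∷ ds)) ys ↭
                  map (λ y → f y d) ys ++ concatMap (λ y → map (f y) ds) ys
  firsts []       = ↭-refl
  firsts (y ∷ ys) = prep (f y d) (↭-trans (↭.++⁺ˡ (map (f y) ds) (firsts ys))
    (↭.shifts (map (f y) ds) (map (λ y → f y d) ys)))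

concatMap-const-↭ : (g : A → List B) (xs : List B) → (∀ d → g d ↭ xs) →
                    (ds : List A) → concatMap g ds ↭ concat (replicate (length ds) xs)
concatMap-const-↭ g xs p []       = ↭-refl
concatMap-const-↭ g xs p (d ∷ ds) = ↭.++⁺ (p d) (concatMap-const-↭ g xs p ds)

replicate-+ : ∀ k l {x : A} → replicate (k + l) x ≡ replicate k x ++ replicate l x
replicate-+ zero    l = refl
replicate-+ (suc k) l = cong (_ ∷_) (replicate-+ k l)

concat-replicate-+ : ∀ k l (xs : List A) →
  concat (replicate (k + l) xs) ≡ concat (replicate k xs) ++ concat (replicate l xs)
concat-replicate-+ k l xs = trans (cong concat (replicate-+ k l)) (sym (concat-++ (replicate k xs) (replicate l xs)))

-- Words with a prescribed pattern

-- The reference word of pattern `σ`: each edge constructed later is a permutation of such a word on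
-- suitable classes.
expand : List ℕ → List A → List A
expand (a ∷ σ) (c ∷ cs) = replicate a c ++ expand σ cs
expand _       _        = []

map-expand : (f : A → B) (σ : List ℕ) (cs : List A) →
             map f (expand σ cs) ≡ expand σ (map f cs)
map-expand f []      cs       = refl
map-expand f (a ∷ σ) []       = refl
map-expand f (a ∷ σ) (c ∷ cs) = trans (map-++ f (replicate a c) _)
  (cong₂ _++_ (map-replicate f a c) (map-expand f σ cs))

length-expand : (σ : List ℕ) (cs : List A) → length σ ≤ length cs →
                length (expand σ cs) ≡ sum σ
length-expand []      cs       _       = refl
length-expand (a ∷ σ) (c ∷ cs) (s≤s p) = trans (length-++ (replicate a c))
  (cong₂ _+_ (length-replicate a) (length-expand σ cs p))

∈-expand : (σ : List ℕ) (cs : List A) {v : A} → v ∈ expand σ cs → v ∈ cs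
∈-expand (a ∷ σ) (c ∷ cs) v∈ with ∈-++⁻ (replicate a c) v∈
... | inj₁ p = here (∈-replicate a p)
  where
  ∈-replicate : ∀ k {v} → v ∈ replicate k c → v ≡ c
  ∈-replicate (suc k) (here p)  = p
  ∈-replicate (suc k) (there p) = ∈-replicate k p
... | inj₂ p = there (∈-expand σ cs p)

module _ {n : ℕ} where

  count-++ : (j : Fin n) (V W : List (Fin n)) → count j (V ++ W) ≡ count j V + count j W
  count-++ j V W = trans (cong length (filter-++ (_≟ j) V W)) (length-++ (filter (_≟ j) V))

  count-∉ : {j : Fin n} {W : List (Fin n)} → j ∉ W → count j W ≡ 0
  count-∉ {j} j∉ = cong length (filter-none (_≟ j)
    {xs = _} (All.tabulate (λ { v∈ refl → j∉ v∈ })))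

  count-replicate-≡ : ∀ a (c : Fin n) → count c (replicate a c) ≡ a
  count-replicate-≡ a c = trans
    (cong length (filter-all (_≟ c) (All.replicate⁺ a refl))) (length-replicate a)

  count-replicate-≢ : ∀ a {c j : Fin n} → c ≢ j → count j (replicate a c) ≡ 0
  count-replicate-≢ a {c} {j} c≢j = cong length (filter-none (_≟ j) (All.replicate⁺ a c≢j))

  -- Since the entries of `cs ++ ds` are distinct, the block of `c` determines the count of `c` and
  -- adds nothing to later counts. Classes left over have count 0 and are filtered out.
  positive-counts : (σ : List ℕ) (cs ds : List (Fin n)) → All (_> 0) σ →
    Unique (cs ++ ds) → length σ ≤ length cs →
    filter (0 <?_) (map (λ j → count j (expand σ cs)) (cs ++ ds)) ≡ σ
  positive-counts [] cs ds _ _ _ = filter-none (0 <?_) (All.map⁺ {xs = cs ++ ds} (All.tabulate (λ _ ())))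
  positive-counts (a ∷ σ) (c ∷ cs) ds (a>0 ∷ pos) (c≢ ∷ u) (s≤s len) = begin
    filter (0 <?_) (count c E ∷ map (λ j → count j E) (cs ++ ds))
      ≡⟨ cong (λ k → filter (0 <?_) (k ∷ map (λ j → count j E) (cs ++ ds))) head≡ ⟩
    filter (0 <?_) (a ∷ map (λ j → count j E) (cs ++ ds))
      ≡⟨ filter-accept (0 <?_) a>0 ⟩
    a ∷ filter (0 <?_) (map (λ j → count j E) (cs ++ ds))
      ≡⟨ cong (λ ks → a ∷ filter (0 <?_) ks) (map-cong-local (All.map tail≡ c≢)) ⟩
    a ∷ filter (0 <?_) (map (λ j → count j (expand σ cs)) (cs ++ ds))
      ≡⟨ cong (a ∷_) (positive-counts σ cs ds pos u len) ⟩
    a ∷ σ ∎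
    where
    open ≡-Reasoning
    E : List (Fin n)
    E = replicate a c ++ expand σ cs
    head≡ : count c E ≡ a
    head≡ = trans (count-++ c (replicate a c) (expand σ cs))
      (trans (cong₂ _+_ (count-replicate-≡ a c)
        (count-∉ {W = expand σ cs} λ c∈ → All.lookup c≢ (∈-++⁺ˡ (∈-expand σ cs c∈)) refl)) (+-identityʳ a))
    tail≡ : ∀ {j} → c ≢ j → count j E ≡ count j (expand σ cs)
    tail≡ {j} c≢j = trans (count-++ j (replicate a c) (expand σ cs))
      (cong (_+ count j (expand σ cs)) (count-replicate-≢ a c≢j))

  expand-pattern : {σ : List ℕ} (cs ds : List (Fin n)) {W : List (Fin n)} → All (_> 0) σ →
    cs ++ ds ↭ allFin n → length σ ≤ length cs → W ↭ expand σ cs → HasPattern σ W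
  expand-pattern {σ} cs ds {W} pos all↭ len W↭ = begin
    filter (0 <?_) (map (λ j → count j W) (allFin n))
      ≡⟨ cong (filter (0 <?_)) (map-cong (λ j → ↭-length (filter-↭ (_≟ j) W↭)) (allFin n)) ⟩
    filter (0 <?_) (map (λ j → count j (expand σ cs)) (allFin n))
      ↭⟨ filter-↭ (0 <?_) (↭.map⁺ _ (↭-sym all↭)) ⟩
    filter (0 <?_) (map (λ j → count j (expand σ cs)) (cs ++ ds))
      ≡⟨ positive-counts σ cs ds pos (Unique-resp-↭ (↭-sym all↭) (Unique.allFin⁺ n)) len ⟩
    σ ∎
    where open PermutationReasoning

-- Initial pieces and intervals

take-++-exact : (k : ℕ) (xs {ys} : List A) → k ≡ length xs → take k (xs ++ ys) ≡ xs
take-++-exact zero    []       eq = refl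
take-++-exact (suc k) (x ∷ xs) eq = cong (x ∷_) (take-++-exact k xs (suc-injective eq))

take-replicate-++ : {k a : ℕ} {x : A} (ys : List A) → k ≤ a →
                    take k (replicate a x ++ ys) ≡ replicate k x
take-replicate-++ ys z≤n     = refl
take-replicate-++ ys (s≤s p) = cong (_ ∷_) (take-replicate-++ ys p)

interval : ℕ → ℕ → List ℕ
interval = iterate suc

interval-+ : ∀ x k l → interval x (k + l) ≡ interval x k ++ interval (k + x) l
interval-+ x zero    l = refl
interval-+ x (suc k) l = cong (x ∷_) (trans (interval-+ (suc x) k l)
  (cong (λ y → interval (suc x) k ++ interval y l) (+-suc k x)))

map-+-interval : ∀ d x k → map (d +_) (interval x k) ≡ interval (d + x) k
map-+-interval d x zero    = refl
map-+-interval d x (suc k) = cong (d + x ∷_)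
  (trans (map-+-interval d (suc x) k) (cong (λ y → interval y k) (+-suc d x)))

interval-tabulate : ∀ {x} k → interval x k ≡ tabulate {n = k} (λ i → toℕ i + x)
interval-tabulate     zero    = refl
interval-tabulate {x} (suc k) = cong (x ∷_) (trans (interval-tabulate k)
  (tabulate-cong (λ i → +-suc (toℕ i) x)))

-- Colour words are obtained from words of offsets in ℕ by translating them
-- and reducing modulo the number of classes.
module _ (n : ℕ) .{{_ : NonZero n}} where

  colour : ℕ → Fin n
  colour u = u mod n

  colour-period : ∀ u k → colour (u + k * n) ≡ colour u
  colour-period u k = toℕ-injective (trans (toℕ-fromℕ< _)
    (trans ([m+kn]%n≡m%n u k n) (sym (toℕ-fromℕ< _))))

  shift : ℕ → List ℕ → List (Fin n)
  shift x = map (λ d → colour (d + x))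

  shift-suc : ∀ x ds → shift (suc x) ds ≡ shift x (map suc ds)
  shift-suc x ds = trans (map-cong (λ d → cong colour (+-suc d x)) ds) (map-∘ ds)

  shift-period : ∀ x k ds → shift (x + k * n) ds ≡ shift x ds
  shift-period x k = map-cong λ d →
    trans (cong colour (sym (+-assoc d x (k * n)))) (colour-period (d + x) k)

  -- Moving a run of `n` consecutive integers by one drops `x` and gains `n + x`, which has the same
  -- colour; so all such runs have the same colours as the run from 0.
  colours-interval : ∀ x → map colour (interval x n) ↭ allFin n
  colours-interval zero = ↭-reflexive (trans (cong (map colour) (interval-tabulate n))
    (trans (map-tabulate {n = n} _ colour)
      (tabulate-cong λ i → toℕ-injective (trans (toℕ-fromℕ< _)
        (trans (cong (_% n) (+-identityʳ (toℕ i))) (m<n⇒m%n≡m (toℕ<n i)))))))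
  colours-interval (suc x) = ↭-trans (↭.drop-∷ (begin
      colour x ∷ map colour (interval (suc x) n)
        ≡⟨ cong (map colour) (trans (cong (interval x) (+-comm 1 n)) (interval-+ x n 1)) ⟩
      map colour (interval x n ∷ʳ (n + x))
        ≡⟨ map-++ colour (interval x n) _ ⟩
      map colour (interval x n) ∷ʳ colour (n + x)
        ≡⟨ cong (map colour (interval x n) ∷ʳ_) wrap ⟩
      map colour (interval x n) ∷ʳ colour x
        ↭⟨ ↭.∷↭∷ʳ (colour x) _ ⟨
      colour x ∷ map colour (interval x n) ∎)) (colours-interval x)
    where
    open PermutationReasoning
    wrap : colour (n + x) ≡ colour x
    wrap = trans (cong colour (trans (+-comm n x) (cong (x +_) (sym (*-identityˡ n))))) (colour-period x 1)

  shift-interval : ∀ x → shift x (interval 0 n) ↭ allFin n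
  shift-interval x = begin
    map (λ d → colour (d + x)) (interval 0 n)  ≡⟨ map-cong (λ d → cong colour (+-comm d x)) (interval 0 n) ⟩
    map (λ d → colour (x + d)) (interval 0 n)  ≡⟨ map-∘ (interval 0 n) ⟩
    map colour (map (x +_) (interval 0 n))     ≡⟨ cong (map colour) (map-+-interval x 0 n) ⟩
    map colour (interval (x + 0) n)            ↭⟨ colours-interval (x + 0) ⟩
    allFin n                                   ∎
    where open PermutationReasoning

  -- For a fixed offset `d` the translates run through `n` consecutive integers and hit every class
  -- once. Hence only the length of `ds` matters, not its shape.
  shifts-balanced : ∀ x ds → concatMap (λ y → shift y ds) (interval x n) ↭
                             concat (replicate (length ds) (allFin n))
  shifts-balanced x ds = ↭-trans (transpose-↭ (λ y d → colour (d + y)) (interval x n) ds)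
    (concatMap-const-↭ (λ d → map (λ y → colour (d + y)) (interval x n)) (allFin n) (λ d → ↭-trans
      (↭-reflexive (trans (map-∘ (interval x n)) (cong (map colour) (map-+-interval d x n))))
      (colours-interval (d + x))) ds)

  -- Translation modulo `n` permutes the classes, so compatibility can be checked on offsets: `cs`
  -- supplies the classes for the parts, and `ds` holds the remaining offsets.
  shift-compatible : ∀ {r σ} (cs ds {xs ys} : List ℕ) (x : ℕ) → All (_> 0) σ →
    cs ++ ds ↭ interval 0 n → length σ ≤ length cs →
    length xs < r → r ∸ length xs ≤ length ys → window r xs ys ↭ expand σ cs →
    Compatible r σ (shift x xs) (shift x ys)
  shift-compatible {r} {σ} cs ds {xs} {ys} x pos all↭ len sh lo w = compatible
    (subst (_< r) (sym (length-map _ xs)) sh)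
    (subst₂ (λ k l → r ∸ k ≤ l) (sym (length-map _ xs)) (sym (length-map _ ys)) lo)
    (expand-pattern (shift x cs) (shift x ds) pos
      (↭-trans (↭-reflexive (sym (map-++ _ cs ds))) (↭-trans (↭.map⁺ _ all↭) (shift-interval x)))
      (subst (length σ ≤_) (sym (length-map _ cs)) len)
      (↭-trans (↭-reflexive (sym (map-window _ r xs ys)))
        (↭-trans (↭.map⁺ _ w) (↭-reflexive (map-expand _ σ cs)))))

-- The construction from translated pairs of edges

-- For σ = a ∷ τ, the edges come in pairs with τ on the same classes and a on
-- the offset 0 or 1. The two edges of a pair overlap inside τ, successive pairs
-- inside their common class for a. The overlap sizes range over [1, Στ] and
-- [1, a], so a pair adds any number r + e with e ≤ r ∸ 2 of new vertices.
module Pairs (k a : ℕ) (τ : List ℕ) (a>0 : a > 0) (τ>0 : All (_> 0) τ)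
             (τ-nonempty : sum τ > 0) (τ-short : length τ ≤ k) where

  private
    n r T : ℕ
    n = 2 + k
    T = sum τ
    r = a + T

    instance
      a≢0 : NonZero a
      a≢0 = >-nonZero a>0

    positive : All (_> 0) (a ∷ τ)
    positive = a>0 ∷ τ>0

    common : List ℕ
    common = interval 2 k

    P : List ℕ
    P = expand τ common

    τ≤common : length τ ≤ length common
    τ≤common = subst (length τ ≤_) (sym (length-iterate suc 2 k)) τ-short

    length-P : length P ≡ T
    length-P = length-expand τ common τ≤common

    -- The excess `e` is split in two. At most `T ∸ 1` of it shrinks the overlap inside the pair,
    -- which therefore stays non-empty; the remainder shrinks the overlap with the next pair.
    private-τ private-a : ℕ → ℕ
    private-τ e = (T ∸ 1) ⊓ e
    private-a e = e ∸ (T ∸ 1)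

  -- `second` opens with what `first` lacks of `P`, so the first edge is the block on 0 together
  -- with `P`. It then repeats the taken part to own a full copy of `P`, and starts the block on 1.
  first second : ℕ → List ℕ
  first e  = replicate a 0 ++ take (private-τ e) P
  second e = drop (private-τ e) P ++ take (private-τ e) P ++ replicate (private-a e) 1

  private
    private-τ<T : ∀ e → private-τ e < T
    private-τ<T e = ≤-<-trans (m⊓n≤m (T ∸ 1) e) (∸-monoʳ-< {T} {1} {0} z<s τ-nonempty)

    -- From `e` at most `r ∸ 2`, which is `(T ∸ 1) + (a ∸ 1)`: at least one vertex of the block on 1
    -- is left to the next pair.
    private-a<a : ∀ {e} → 2 + e ≤ r → private-a e < a
    private-a<a {e} le = m<n+o⇒m∸n<o e (T ∸ 1) (s≤s⁻¹ (begin
      2 + e             ≤⟨ le ⟩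
      a + T             ≡⟨ +-comm a T ⟩
      T + a             ≡⟨ cong (_+ a) (m+[n∸m]≡n τ-nonempty) ⟨
      suc (T ∸ 1 + a)   ∎))
      where open ≤-Reasoning

    length-first : ∀ e → length (first e) ≡ a + private-τ e
    length-first e = trans (length-++ (replicate a 0)) (cong₂ _+_ (length-replicate a)
      (trans (length-take (private-τ e) P) (m≤n⇒m⊓n≡m
        (subst (private-τ e ≤_) (sym length-P) (<⇒≤ (private-τ<T e))))))

    length-drop-P : ∀ e → length (drop (private-τ e) P) ≡ T ∸ private-τ e
    length-drop-P e = trans (length-drop (private-τ e) P) (cong (_∸ private-τ e) length-P)

    drop++take : ∀ e → drop (private-τ e) P ++ take (private-τ e) P ↭ P
    drop++take e = ↭-trans (↭.++-comm (drop (private-τ e) P) _)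
      (↭-reflexive (take++drop≡id (private-τ e) P))

    length-second : ∀ e → length (second e) ≡ T + private-a e
    length-second e = trans (cong length (sym (++-assoc (drop (private-τ e) P) _ _)))
      (trans (length-++ (drop (private-τ e) P ++ take (private-τ e) P))
        (cong₂ _+_ (trans (↭-length (drop++take e)) length-P) (length-replicate (private-a e))))

    length-pair : ∀ e → length (first e ++ second e) ≡ r + e
    length-pair e = begin
      length (first e ++ second e)               ≡⟨ length-++ (first e) ⟩
      length (first e) + length (second e)       ≡⟨ cong₂ _+_ (length-first e) (length-second e) ⟩
      (a + private-τ e) + (T + private-a e)      ≡⟨ interchange a (private-τ e) T (private-a e) ⟩
      (a + T) + (private-τ e + private-a e)      ≡⟨ cong (r +_) (m⊓n+n∸m≡n (T ∸ 1) e) ⟩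
      r + e                                      ∎
      where open ≡-Reasoning

    r∸first : ∀ e → r ∸ length (first e) ≡ T ∸ private-τ e
    r∸first e = trans (cong (r ∸_) (length-first e)) ([m+n]∸[m+o]≡n∸o a T (private-τ e))

    r∸second : ∀ e → r ∸ length (second e) ≡ a ∸ private-a e
    r∸second e = trans (cong₂ _∸_ (+-comm a T) (length-second e)) ([m+n]∸[m+o]≡n∸o T a (private-a e))

    first-second : ∀ x e → Compatible {n} r (a ∷ τ) (shift n x (first e)) (shift n x (second e))
    first-second x e = shift-compatible n (0 ∷ common) (1 ∷ []) x positive
      (prep 0 (↭-sym (↭.∷↭∷ʳ 1 common))) (s≤s τ≤common)
      (subst (_< r) (sym (length-first e)) (+-monoʳ-< a (private-τ<T e)))
      (subst₂ _≤_ (sym (r∸first e)) (sym (length-second e)) (≤-trans (m∸n≤m T (private-τ e)) (m≤m+n T _)))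
      (↭-reflexive (begin
        first e ++ take (r ∸ length (first e)) (second e)
          ≡⟨ cong (λ l → first e ++ take l (second e)) (r∸first e) ⟩
        first e ++ take (T ∸ private-τ e) (second e)
          ≡⟨ cong (first e ++_) (take-++-exact _ (drop (private-τ e) P) (sym (length-drop-P e))) ⟩
        first e ++ drop (private-τ e) P
          ≡⟨ ++-assoc (replicate a 0) _ _ ⟩
        replicate a 0 ++ take (private-τ e) P ++ drop (private-τ e) P
          ≡⟨ cong (replicate a 0 ++_) (take++drop≡id (private-τ e) P) ⟩
        replicate a 0 ++ P ∎))
      where open ≡-Reasoning

    -- The next pair is translated by one, so its block on 0 sits on offset 1 here and supplies the
    -- missing `a ∸ h` entries. The edge never goes past that block, so `e′` is arbitrary and pairs
    -- of different excess can follow each other.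
    second-first : ∀ x e e′ → 2 + e ≤ r →
      Compatible {n} r (a ∷ τ) (shift n x (second e)) (shift n (suc x) (first e′))
    second-first x e e′ le = subst (Compatible r (a ∷ τ) (shift n x (second e))) (sym (shift-suc n x (first e′)))
      (shift-compatible n (1 ∷ common) (0 ∷ []) x positive
        (↭-sym (↭.∷↭∷ʳ 0 (1 ∷ common))) (s≤s τ≤common)
        (subst₂ _<_ (sym (length-second e)) (+-comm T a) (+-monoʳ-< T h<a))
        (subst₂ _≤_ (sym (r∸second e)) (sym (trans (length-map suc (first e′)) (length-first e′)))
          (≤-trans (m∸n≤m a h) (m≤m+n a _)))
        (begin
          second e ++ take (r ∸ length (second e)) (map suc (first e′))
            ≡⟨ cong (second e ++_) (trans (cong (λ l → take l (map suc (first e′))) (r∸second e))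
                 (trans (cong (take (a ∸ h)) (trans (map-++ suc (replicate a 0) _)
                          (cong (_++ map suc (take (private-τ e′) P)) (map-replicate suc a 0))))
                        (take-replicate-++ _ (m∸n≤m a h)))) ⟩
          second e ++ replicate (a ∸ h) 1
            ≡⟨ cong (_++ replicate (a ∸ h) 1) (sym (++-assoc (drop (private-τ e) P) _ _)) ⟩
          ((drop (private-τ e) P ++ take (private-τ e) P) ++ replicate h 1) ++ replicate (a ∸ h) 1
            ≡⟨ ++-assoc (drop (private-τ e) P ++ take (private-τ e) P) _ _ ⟩
          (drop (private-τ e) P ++ take (private-τ e) P) ++ replicate h 1 ++ replicate (a ∸ h) 1
            ≡⟨ cong ((drop (private-τ e) P ++ take (private-τ e) P) ++_)
                 (trans (sym (replicate-+ h (a ∸ h))) (cong (λ l → replicate l 1) (m+[n∸m]≡n (<⇒≤ h<a)))) ⟩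
          (drop (private-τ e) P ++ take (private-τ e) P) ++ replicate a 1
            ↭⟨ ↭.++⁺ʳ (replicate a 1) (drop++take e) ⟩
          P ++ replicate a 1
            ↭⟨ ↭.++-comm P (replicate a 1) ⟩
          replicate a 1 ++ P ∎))
      where
      open PermutationReasoning
      h : ℕ
      h = private-a e
      h<a : h < a
      h<a = private-a<a le

  segments : ℕ → List ℕ → List (List (Fin n))
  segments x []       = []
  segments x (e ∷ es) = shift n x (first e) ∷ shift n x (second e) ∷ segments (suc x) es

  segments-++ : ∀ x es fs → segments x (es ++ fs) ≡ segments x es ++ segments (length es + x) fs
  segments-++ x []       fs = refl
  segments-++ x (e ∷ es) fs = cong (λ t → shift n x (first e) ∷ shift n x (second e) ∷ t)
    (trans (segments-++ (suc x) es fs) (cong (λ y → segments (suc x) es ++ segments y fs) (+-suc (length es) x)))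

  segments-linked : ∀ x es e′ → All (λ e → 2 + e ≤ r) es →
    Linked (Compatible {n} r (a ∷ τ)) (segments x es ++ shift n (length es + x) (first e′) ∷ [])
  segments-linked x []           e′ []        = [-]
  segments-linked x (e ∷ [])     e′ (le ∷ []) = first-second x e ∷ second-first x e e′ le ∷ [-]
  segments-linked x (e ∷ f ∷ es) e′ (le ∷ ls) = first-second x e ∷ second-first x e f le ∷
    subst (λ y → Linked (Compatible r (a ∷ τ)) (segments (suc x) (f ∷ es) ++ shift n y (first e′) ∷ []))
          (cong suc (+-suc (length es) x)) (segments-linked (suc x) (f ∷ es) e′ ls)

  segments-replicate : ∀ x m e → concat (segments x (replicate m e)) ≡
    concatMap (λ y → shift n y (first e ++ second e)) (interval x m)
  segments-replicate x zero    e = refl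
  segments-replicate x (suc m) e = trans (sym (++-assoc (shift n x (first e)) _ _))
    (cong₂ _++_ (sym (map-++ _ (first e) (second e))) (segments-replicate (suc x) m e))

  -- Each excess is used for `n` successive translates. Whatever their starting point, these
  -- contribute `r + e` copies of every class.
  segments-balanced : ∀ x es → concat (segments x (concatMap (replicate n) es)) ↭
    concat (replicate (sum (map (r +_) es)) (allFin n))
  segments-balanced x []       = ↭-refl
  segments-balanced x (e ∷ es) = begin
    concat (segments x (replicate n e ++ concatMap (replicate n) es))
      ≡⟨ cong concat (segments-++ x (replicate n e) _) ⟩
    concat (segments x (replicate n e) ++ segments x′ (concatMap (replicate n) es))
      ≡⟨ concat-++ (segments x (replicate n e)) _ ⟨
    concat (segments x (replicate n e)) ++ concat (segments x′ (concatMap (replicate n) es))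
      ↭⟨ ↭.++⁺ one (segments-balanced x′ es) ⟩
    concat (replicate (r + e) (allFin n)) ++ concat (replicate (sum (map (r +_) es)) (allFin n))
      ≡⟨ concat-replicate-+ (r + e) _ (allFin n) ⟨
    concat (replicate (r + e + sum (map (r +_) es)) (allFin n)) ∎
    where
    open PermutationReasoning
    x′ : ℕ
    x′ = length (replicate n e) + x
    one : concat (segments x (replicate n e)) ↭ concat (replicate (r + e) (allFin n))
    one = ↭-trans (↭-reflexive (segments-replicate x n e)) (↭-trans (shifts-balanced n x (first e ++ second e))
      (↭-reflexive (cong (λ l → concat (replicate l (allFin n))) (length-pair e))))

  length-rows : ∀ (es : List ℕ) → length (concatMap (replicate n) es) ≡ length es * n
  length-rows []       = refl
  length-rows (e ∷ es) = trans (length-++ (replicate n e)) (cong₂ _+_ (length-replicate n) (length-rows es))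

  pairs⇒hamiltonian : ∀ e es → All (λ e → 2 + e ≤ r) (e ∷ es) →
    HasSharpHamiltonianCycle (σ-hypergraph n r (sum (map (r +_) (e ∷ es))) (a ∷ τ))
  pairs⇒hamiltonian e es le = colours⇒hamiltonian n r (sum (map (r +_) (e ∷ es))) (a ∷ τ) _ _
    (segments-balanced 0 (e ∷ es)) (s≤s z≤n)
    (subst (λ z → Linked (Compatible r (a ∷ τ)) (segments 0 rows ++ z ∷ [])) closes
      (segments-linked 0 rows e (All.concat⁺ (All.map⁺ (All.map (All.replicate⁺ n) le)))))
    where
    rows : List ℕ
    rows = concatMap (replicate n) (e ∷ es)
    -- The number of pairs is a multiple of `n`, so the translation after the last pair is trivial
    -- modulo `n` and the word closes up on its first segment.
    closes : shift n (length rows + 0) (first e) ≡ shift n 0 (first e)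
    closes = trans (cong (λ l → shift n l (first e)) (trans (+-identityʳ _) (length-rows (e ∷ es))))
                   (shift-period n 0 (suc (length es)) (first e))

-- The graph case, and `q` as a sum of pair contributions

-- When r = 2 a pair admits only e = 0, hence only even q. Here the cyclic
-- sequence of classes 0, 1, …, n ∸ 1, 0, 1, … does it.
graph-hamiltonian : ∀ k q → HasSharpHamiltonianCycle (σ-hypergraph (3 + k) 2 (suc q) (1 ∷ 1 ∷ []))
graph-hamiltonian k q = colours⇒hamiltonian n 2 (suc q) (1 ∷ 1 ∷ []) (vertex 0) (map vertex (interval 1 m))
  (↭-trans (↭-reflexive (concat-vertices 0 (suc m))) (laps (suc q) 0)) (s≤s z≤n)
  (subst (λ z → Linked (Compatible 2 (1 ∷ 1 ∷ [])) (map vertex (interval 0 (suc m)) ++ z ∷ []))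
    (shift-period n 0 (suc q) (0 ∷ [])) (linked 0 (suc m)))
  where
  n : ℕ
  n = 3 + k
  -- Chosen so that `suc m` is `suc q * n`, the number of vertices.
  m : ℕ
  m = 2 + k + q * n
  vertex : ℕ → List (Fin n)
  vertex x = shift n x (0 ∷ [])
  concat-vertices : ∀ x m → concat (map vertex (interval x m)) ≡ map (colour n) (interval x m)
  concat-vertices x zero    = refl
  concat-vertices x (suc m) = cong (colour n x ∷_) (concat-vertices (suc x) m)
  laps : ∀ q x → map (colour n) (interval x (q * n)) ↭ concat (replicate q (allFin n))
  laps zero    x = ↭-refl
  laps (suc q) x = ↭-trans
    (↭-reflexive (trans (cong (map (colour n)) (interval-+ x n (q * n)))
      (map-++ (colour n) (interval x n) _)))
    (↭.++⁺ (colours-interval n x) (laps q (n + x)))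
  step : ∀ x → Compatible 2 (1 ∷ 1 ∷ []) (vertex x) (vertex (suc x))
  step x = shift-compatible n (0 ∷ 1 ∷ []) (interval 2 (suc k)) {0 ∷ []} {1 ∷ []} x
    (z<s ∷ z<s ∷ []) ↭-refl ≤-refl ≤-refl ≤-refl ↭-refl
  linked : ∀ x m → Linked (Compatible 2 (1 ∷ 1 ∷ [])) (map vertex (interval x m) ++ vertex (x + m) ∷ [])
  linked x zero          = [-]
  linked x (suc zero)    rewrite +-comm x 1 = step x ∷ [-]
  linked x (suc (suc m)) = step x ∷ subst
    (λ y → Linked (Compatible 2 (1 ∷ 1 ∷ [])) (map vertex (interval (suc x) (suc m)) ++ vertex y ∷ []))
    (sym (+-suc x (suc m))) (linked (suc x) (suc m))

-- q = M r + c with c < r, and M ≥ 2 leaves room to spread c over two terms.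
excesses : ∀ r q → 3 ≤ r → q ≥ r * (r ∸ 1) →
           ∃₂ λ e es → All (λ e → 2 + e ≤ r) (e ∷ es) × q ≡ sum (map (r +_) (e ∷ es))
excesses r q r≥3 q≥ = go (q / r) (q % r) quotient≥2 (m%n<n q r) (m≡m%n+[m/n]*n q r)
  where
  instance
    r≢0 : NonZero r
    r≢0 = >-nonZero (≤-trans z<s r≥3)
  2≤r : 2 ≤ r
  2≤r = <⇒≤ r≥3
  quotient≥2 : 2 ≤ q / r
  quotient≥2 = begin
    2                    ≤⟨ ∸-monoˡ-≤ 1 r≥3 ⟩
    r ∸ 1                ≡⟨ m*n/n≡m (r ∸ 1) r ⟨
    (r ∸ 1) * r / r      ≡⟨ cong (_/ r) (*-comm (r ∸ 1) r) ⟩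
    r * (r ∸ 1) / r      ≤⟨ /-monoˡ-≤ r q≥ ⟩
    q / r                ∎
    where open ≤-Reasoning
  sum-zeros : ∀ M → sum (map (r +_) (replicate M 0)) ≡ M * r
  sum-zeros zero    = refl
  sum-zeros (suc M) = cong₂ _+_ (+-identityʳ r) (sum-zeros M)
  go : ∀ M c → 2 ≤ M → c < r → q ≡ c + M * r →
       ∃₂ λ e es → All (λ e → 2 + e ≤ r) (e ∷ es) × q ≡ sum (map (r +_) (e ∷ es))
  go (suc zero) _ (s≤s ())
  go (suc (suc M)) zero _ _ eq = 0 , 0 ∷ replicate M 0 ,
    2≤r ∷ 2≤r ∷ All.replicate⁺ M 2≤r , trans eq (sym (sum-zeros (2 + M)))
  -- A remainder `suc c` can be as large as `r ∸ 1`, while an excess is at most `r ∸ 2`. So one unit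
  -- goes to a second term, where excess 1 is admissible because `r` is at least 3.
  go (suc (suc M)) (suc c) _ c<r eq = c , 1 ∷ replicate M 0 ,
    c<r ∷ r≥3 ∷ All.replicate⁺ M 2≤r , trans eq (begin
      suc c + (r + (r + M * r))      ≡⟨ solve 3 (λ c r m →
                                          con 1 :+ c :+ (r :+ (r :+ m)) := (r :+ c) :+ ((r :+ con 1) :+ m)) refl c r (M * r) ⟩
      (r + c) + ((r + 1) + M * r)    ≡⟨ cong (λ z → (r + c) + ((r + 1) + z)) (sum-zeros M) ⟨
      (r + c) + ((r + 1) + sum (map (r +_) (replicate M 0))) ∎)
    where
    open ≡-Reasoning
    open +-*-Solver

pair-of-ones : ∀ a b τ → All (_> 0) (a ∷ b ∷ τ) → 2 ≡ sum (a ∷ b ∷ τ) →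
               _≡_ {A = List ℕ} (a ∷ b ∷ τ) (1 ∷ 1 ∷ [])
pair-of-ones (suc zero) (suc zero) [] _ _ = refl
pair-of-ones (suc zero) (suc zero) (suc c ∷ τ) _ ()
pair-of-ones (suc zero) (suc zero) (zero ∷ τ) (_ ∷ _ ∷ () ∷ _) _
pair-of-ones (suc zero) (suc (suc b)) τ _ ()
pair-of-ones (suc zero) zero τ (_ ∷ () ∷ _) _
pair-of-ones (suc (suc zero)) (suc b) τ _ ()
pair-of-ones (suc (suc zero)) zero τ (_ ∷ () ∷ _) _
pair-of-ones (suc (suc (suc a))) b τ _ ()
pair-of-ones zero b τ (() ∷ _) _

-- Combining the cases

hamiltonian-r≡2 : ∀ n r q σ → r ≡ 2 → σ ≡ 1 ∷ 1 ∷ [] → q ≥ r * (r ∸ 1) → n ≥ length σ + 1 →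
                  HasSharpHamiltonianCycle (σ-hypergraph n r q σ)
hamiltonian-r≡2 (suc (suc (suc k))) _ (suc q) _ refl refl _ _ = graph-hamiltonian k q
hamiltonian-r≡2 (suc zero)          _ _       _ refl refl _ (s≤s ())
hamiltonian-r≡2 (suc (suc zero))    _ _       _ refl refl _ (s≤s (s≤s ()))

hamiltonian-r≥3 : ∀ n r q a τ → r ≡ a + sum τ → a > 0 → All (_> 0) τ → sum τ > 0 →
                  3 ≤ r → q ≥ r * (r ∸ 1) → n ≥ length (a ∷ τ) + 1 →
                  HasSharpHamiltonianCycle (σ-hypergraph n r q (a ∷ τ))
hamiltonian-r≥3 n r q a τ r≡ a>0 τ>0 sum>0 3≤r q≥ n≥ =
  let e , es , excess , q≡ = excesses r q 3≤r q≥ in assemble n r≡ excess q≡ n≥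
  where
  -- `r` and `q` are generalised so that their equations can be matched.
  assemble : ∀ n {r q e es} → r ≡ a + sum τ → All (λ e → 2 + e ≤ r) (e ∷ es) →
             q ≡ sum (map (r +_) (e ∷ es)) → n ≥ length (a ∷ τ) + 1 →
             HasSharpHamiltonianCycle (σ-hypergraph n r q (a ∷ τ))
  assemble (suc (suc k)) refl excess refl (s≤s n≥) =
    Pairs.pairs⇒hamiltonian k a τ a>0 τ>0 sum>0
      -- Two of the `n` classes are reserved for the part `a`; the bound on `n` leaves at least
      -- `length τ` others.
      (s≤s⁻¹ (subst (_≤ suc k) (+-comm (length τ) 1) n≥)) _ _ excess
  assemble (suc zero) _ _ _ (s≤s n≥) = contradiction (subst (_≤ 0) (+-comm (length τ) 1) n≥) λ ()

theorem3p6 : (n r q : ℕ) (σ : List ℕ) →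
    IsPartition r σ →
    q ≥ largestPart σ →
    n ≥ length σ →
    length σ ≥ 2 →
    q ≥ r * (r ∸ 1) →
    n ≥ length σ + 1 →
    HasSharpHamiltonianCycle (σ-hypergraph n r q σ)
theorem3p6 n r q (a ∷ b ∷ τ) σ-partition _ _ _ q≥ n≥ = Sum.[
    (λ r>2 → hamiltonian-r≥3 n r q a (b ∷ τ) r≡ (All.head positive) (All.tail positive) sum>0 r>2 q≥ n≥) ,
    (λ 2≡r → hamiltonian-r≡2 n r q (a ∷ b ∷ τ) (sym 2≡r)
      (pair-of-ones a b τ positive (trans 2≡r r≡)) q≥ n≥) ]
  -- Two positive parts give `r` at least 2, and equality is the graph case.
  (m≤n⇒m<n∨m≡n (subst (2 ≤_) (sym r≡) (+-mono-≤ (All.head positive) sum>0)))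
  where
  positive : All (_> 0) (a ∷ b ∷ τ)
  positive = IsPartition.parts-positive σ-partition
  r≡ : r ≡ a + (b + sum τ)
  r≡ = sym (IsPartition.parts-sum σ-partition)
  sum>0 : b + sum τ > 0
  sum>0 = ≤-trans (All.head (All.tail positive)) (m≤m+n b (sum τ))
theorem3p6 n r q (_ ∷ []) _ _ _ (s≤s ())
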